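{- For every $p,d\in\mathbb N$, the class $\mathcal{C}_{p,d}$ of all finite graphs $G$ that satisfy $\mathrm{Sep}(G,p)\le d$ and that do not contain the complete bipartite graph $K_{p,p}$ as a minor is $\mathrm{MSO}_2$-orderable.
   Context: Graphs are finite, simple, loop-free, undirected. $\mathrm{Sep}(G,k)$ is the maximal number of connected components of $G-S$ where $S$ ranges over vertex sets of size at most $k$. For a graph $G=\langle V,E\rangle$, $\lceil G\rceil=\langle V\cup E,\mathrm{inc}\rangle$ is the structure with universe $V\cup E$ and the vertex–edge incidence relation. A class $\mathcal C$ of graphs is $\mathrm{MSO}_2$-orderable if there is a monadic second-order formula $\varphi(x,y;Z_0,\dots,Z_{n-1})$ such that for every nonempty $G\in\mathcal C$ there are sets $P_0,\dots,P_{n-1}\subseteq V\cup E$ for which $\{(a,b):\lceil G\rceil\models\varphi(a,b;\bar P)\}$ is a linear order on $V\cup E$. -}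

module Defs where

open import Data.Nat using (ℕ; zero; suc; _+_; _≤_; _<_)
open import Data.Fin using (Fin; toℕ; splitAt)
open import Data.Fin.Subset using (Subset; _∈_; _∉_; ∣_∣)
open import Data.Bool using (Bool; true; false; _≟_)
open import Data.Maybe using (Maybe; just; nothing)
open import Data.Product using (Σ; _×_; _,_; ∃)
open import Data.Sum using (_⊎_; inj₁; inj₂)
open import Data.Empty using (⊥)
open import Data.Vec.Functional using (_∷_)
open import Relation.Nullary using (¬_)
open import Relation.Binary.PropositionalEquality using (_≡_; _≢_)

record Graph : Set where
  field
    n     : ℕ
    adj   : Fin n → Fin n → Bool
    sym   : ∀ i j → adj i j ≡ adj j i
    irrefl : ∀ i → adj i i ≡ false
open Graph public

Vertex : Graph → Set
Vertex G = Fin (n G)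

-- an edge {i,j} is represented once, as the pair (i , j) with i < j
Edge : Graph → Set
Edge G = Σ (Fin (n G) × Fin (n G)) λ { (i , j) → (toℕ i < toℕ j) × (adj G i j ≡ true) }

Elem : Graph → Set
Elem G = Vertex G ⊎ Edge G

Inc : (G : Graph) → Elem G → Elem G → Set
Inc G (inj₁ v) (inj₂ ((i , j) , _)) = (v ≡ i) ⊎ (v ≡ j)
Inc G _ _ = ⊥

NonemptyGraph : Graph → Set
NonemptyGraph G = Elem G

data Formula (m k : ℕ) : Set where
  eqF  : Fin m → Fin m → Formula m k
  incF : Fin m → Fin m → Formula m k
  memF : Fin m → Fin k → Formula m k
  negF : Formula m k → Formula m k
  andF : Formula m k → Formula m k → Formula m k
  ex1F : Formula (suc m) k → Formula m k
  ex2F : Formula m (suc k) → Formula m k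

ElemSet : Graph → Set
ElemSet G = Elem G → Bool

Sat : (G : Graph) {m k : ℕ} → Formula m k →
      (Fin m → Elem G) → (Fin k → ElemSet G) → Set
Sat G (eqF x y)   ρ σ = ρ x ≡ ρ y
Sat G (incF x y)  ρ σ = Inc G (ρ x) (ρ y)
Sat G (memF x X)  ρ σ = σ X (ρ x) ≡ true
Sat G (negF φ)    ρ σ = ¬ Sat G φ ρ σ
Sat G (andF φ ψ)  ρ σ = Sat G φ ρ σ × Sat G ψ ρ σ
Sat G (ex1F φ)    ρ σ = Σ (Elem G) λ a → Sat G φ (a ∷ ρ) σ
Sat G (ex2F φ)    ρ σ = Σ (ElemSet G) λ Z → Sat G φ ρ (Z ∷ σ)

record IsLinearOrder {A : Set} (R : A → A → Set) : Set where
  field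
    refl    : ∀ a → R a a
    antisym : ∀ a b → R a b → R b a → a ≡ b
    trans   : ∀ a b c → R a b → R b c → R a c
    total   : ∀ a b → R a b ⊎ R b a

Class : Set₁
Class = Graph → Set

MSO2-orderable : Class → Set
MSO2-orderable C =
  Σ ℕ λ k → Σ (Formula 2 k) λ φ →
    ∀ (G : Graph) → C G → NonemptyGraph G →
      Σ (Fin k → ElemSet G) λ P →
        IsLinearOrder {Elem G} (λ a b → Sat G φ (a ∷ (b ∷ λ ())) P)

data ConnectedAvoiding (G : Graph) (S : Subset (n G)) : Vertex G → Vertex G → Set where
  here : ∀ {u} → u ∉ S → ConnectedAvoiding G S u u
  step : ∀ {u v w} → u ∉ S → adj G u v ≡ true →
         ConnectedAvoiding G S v w → ConnectedAvoiding G S u w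

-- G - S has at most d connected components: there is a map from the
-- vertices of G - S to Fin d identifying exactly the connected pairs
-- (i.e. an injection of the set of components into Fin d).
ComponentsAtMost : (G : Graph) → Subset (n G) → ℕ → Set
ComponentsAtMost G S d =
  Σ ((v : Vertex G) → v ∉ S → Fin d) λ f →
    ∀ u v (u∉ : u ∉ S) (v∉ : v ∉ S) →
      (f u u∉ ≡ f v v∉ → ConnectedAvoiding G S u v) ×
      (ConnectedAvoiding G S u v → f u u∉ ≡ f v v∉)

SepAtMost : Graph → ℕ → ℕ → Set
SepAtMost G k d = ∀ (S : Subset (n G)) → ∣ S ∣ ≤ k → ComponentsAtMost G S d

data ConnectedIn (G : Graph) {m : ℕ} (β : Vertex G → Maybe (Fin m)) (h : Fin m)
     : Vertex G → Vertex G → Set where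
  here : ∀ {u} → β u ≡ just h → ConnectedIn G β h u u
  step : ∀ {u v w} → β u ≡ just h → adj G u v ≡ true →
         ConnectedIn G β h v w → ConnectedIn G β h u w

-- H is a minor of G: there are pairwise disjoint (β is a function),
-- nonempty, connected branch sets β⁻¹(h), h ∈ V(H), such that for every
-- edge hh' of H some edge of G joins the branch sets of h and h'.
IsMinor : Graph → Graph → Set
IsMinor H G =
  Σ (Vertex G → Maybe (Fin (n H))) λ β →
    (∀ h → Σ (Vertex G) λ v → β v ≡ just h) ×
    (∀ h u v → β u ≡ just h → β v ≡ just h → ConnectedIn G β h u v) ×
    (∀ h h' → adj H h h' ≡ true →
       Σ (Vertex G) λ u → Σ (Vertex G) λ v →
         (β u ≡ just h) × (β v ≡ just h') × (adj G u v ≡ true))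

side : ∀ p q → Fin (p + q) → Bool
side p q i with splitAt p i
... | inj₁ _ = true
... | inj₂ _ = false

xor : Bool → Bool → Bool
xor true  b = Data.Bool.not b
xor false b = b

K : ℕ → ℕ → Graph
K p q = record
  { n = p + q
  ; adj = λ i j → xor (side p q i) (side p q j)
  ; sym = λ i j → xor-comm (side p q i) (side p q j)
  ; irrefl = λ i → xor-self (side p q i)
  }
  where
    open import Relation.Binary.PropositionalEquality using (refl)
    xor-comm : ∀ a b → xor a b ≡ xor b a
    xor-comm true true = refl
    xor-comm true false = refl
    xor-comm false true = refl
    xor-comm false false = refl
    xor-self : ∀ a → xor a a ≡ false
    xor-self true = refl
    xor-self false = refl

C : ℕ → ℕ → Class
C p d G = SepAtMost G p d × ¬ IsMinor (K p p) G

{-# OPTIONS --safe #-}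

-- Take a depth-first search forest of G: every edge joins a vertex to one of its
-- ancestors. Let U(x) be the set of proper ancestors of x that have a neighbour
-- in the subtree T(x). Siblings with distinct sets U are ordered
-- lexicographically along the path of their common ancestors. Siblings with the
-- same set U have disjoint connected subtrees T, each joined to every vertex of
-- U: if |U| ≤ p, these subtrees lie in distinct components of G − U, so there
-- are at most d of them; if |U| > p, then p of them together with p vertices
-- of U would form a K_{p,p} minor. Hence boundedly many colours separate such
-- siblings, and ordering siblings orders the forest. The forest itself is
-- recovered from one set parameter.

module Submission where

open import Axiom.UniquenessOfIdentityProofs.WithK using (uip)
open import Data.Bool using (Bool; true; false; not)
import Data.Bool.Properties as Bool
open import Data.Empty using (⊥; ⊥-elim)
open import Data.Fin as Fin using (Fin; zero; suc; toℕ; fromℕ<; inject≤; splitAt; join)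
import Data.Fin.Properties as Fin
open import Data.Fin.Subset using (Subset; _∈_; _∉_; ∣_∣)
open import Data.Maybe using (Maybe; just; nothing)
open import Data.Maybe.Properties using (just-injective)
open import Data.Nat using (ℕ; zero; suc; _+_; _∸_; _≤_; _<_; _≤?_; s≤s; z≤n)
open import Data.Nat.Induction using (<-wellFounded)
import Data.Nat.Properties as ℕ
open import Algebra.Properties.Monoid.Sum ℕ.+-0-monoid using (sum)
open import Data.Product using (Σ; ∃; _×_; _,_; proj₁; proj₂)
open import Data.Product.Properties using () renaming (≡-dec to ×-≡-dec)
open import Data.Sum as Sum using (_⊎_; inj₁; inj₂; [_,_])
open import Data.Sum.Properties using () renaming (≡-dec to ⊎-≡-dec)
open import Data.Vec using (_∷_; here; there; tabulate)
open import Data.Vec.Functional using () renaming (_∷_ to _◂_)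
open import Data.Vec.Properties using (lookup∘tabulate; tabulate-cong; []=⇒lookup; lookup⇒[]=)
open import Function using (_∘_; id)
open import Induction.WellFounded using (Acc; acc)
open import Relation.Binary using (tri<; tri≈; tri>)
open import Relation.Binary.PropositionalEquality using (_≡_; _≢_; refl; cong; cong₂; subst)
  renaming (sym to ≡-sym; trans to ≡-trans)
open import Relation.Nullary using (¬_; Dec; yes; no; does; ¬?; _×-dec_; _→-dec_; _⊎-dec_; contradiction)
open import Relation.Nullary.Decidable using (map′; decidable-stable; dec-true)

open import Defs

-- Decidable quantification

infix 3 _⟺_
_⟺_ : Set → Set → Set
A ⟺ B = (A → B) × (B → A)

_⟺-dec_ : {A B : Set} → Dec A → Dec B → Dec (A ⟺ B)
a ⟺-dec b = (a →-dec b) ×-dec (b →-dec a)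

Searchable : Set → Set₁
Searchable X = {P : X → Set} → (∀ x → Dec (P x)) → Dec (∃ P)

search-all : {X : Set} → Searchable X → {P : X → Set} → (∀ x → Dec (P x)) → Dec (∀ x → P x)
search-all any? P? with any? (¬? ∘ P?)
... | yes (x , ¬p) = no λ p → ¬p (p x)
... | no ¬∃ = yes λ x → decidable-stable (P? x) λ ¬p → ¬∃ (x , ¬p)

-- The linear order induced by a forest order

module ForestOrder
  {X : Set} (any? : Searchable X) (_≟_ : (x y : X) → Dec (x ≡ y))
  (_≼_ : X → X → Set) (_≼?_ : ∀ x y → Dec (x ≼ y))
  (≼-refl : ∀ {x} → x ≼ x)
  (≼-trans : ∀ {x y z} → x ≼ y → y ≼ z → x ≼ z)
  (≼-chain : ∀ {x y z} → x ≼ z → y ≼ z → x ≼ y ⊎ y ≼ x)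
  (height : X → ℕ)
  (height-mono : ∀ {x y} → x ≼ y → x ≢ y → height x < height y)
  (I : X → X → Set) (I? : ∀ x y → Dec (I x y))
  where

  infix 4 _≺_
  _≺_ : X → X → Set
  x ≺ y = x ≼ y × x ≢ y

  -- Defined through proper ancestors alone, so any two roots also count as siblings.
  Sib : X → X → Set
  Sib x y = ∀ z → z ≺ x ⟺ z ≺ y

  -- In the application `I` is incidence: a vertex above `x` belongs to the set when it is an end of
  -- an edge lying at or below `x` in the order.
  U : X → X → Set
  U x a = a ≺ x × ∃ λ w → x ≼ w × I a w

  SameU : X → X → Set
  SameU x y = ∀ a → U x a ⟺ U y a

  -- The proper ancestors of siblings form one chain; `v` is the topmost place on it where the two
  -- sets differ, and the element owning it comes first.
  Lex : X → X → Set
  Lex x y = ∃ λ v → (U x v × ¬ U y v) × (∀ w → w ≺ v → U x w ⟺ U y w)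

  _≺?_ : ∀ x y → Dec (x ≺ y)
  x ≺? y = (x ≼? y) ×-dec ¬? (x ≟ y)

  Sib? : ∀ x y → Dec (Sib x y)
  Sib? x y = search-all any? λ z → (z ≺? x) ⟺-dec (z ≺? y)

  U? : ∀ x a → Dec (U x a)
  U? x a = (a ≺? x) ×-dec any? λ w → (x ≼? w) ×-dec I? a w

  SameU? : ∀ x y → Dec (SameU x y)
  SameU? x y = search-all any? λ a → U? x a ⟺-dec U? y a

  ≼-antisym : ∀ {x y} → x ≼ y → y ≼ x → x ≡ y
  ≼-antisym {x} {y} p q with x ≟ y
  ... | yes e = e
  ... | no e = ⊥-elim (ℕ.<-asym (height-mono p e) (height-mono q (e ∘ ≡-sym)))

  ≺-trans : ∀ {x y z} → x ≺ y → y ≺ z → x ≺ z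
  ≺-trans (p , e) (q , f) = ≼-trans p q , λ { refl → e (≼-antisym p q) }

  ≼⊎≻ : ∀ {x y z} → x ≼ z → y ≼ z → x ≼ y ⊎ y ≺ x
  ≼⊎≻ {x} {y} p q with x ≼? y | ≼-chain p q
  ... | yes r | _ = inj₁ r
  ... | no _ | inj₁ r = inj₁ r
  ... | no ¬r | inj₂ s = inj₂ (s , λ { refl → ¬r ≼-refl })

  minimal : {P : X → Set} → (∀ x → Dec (P x)) → ∃ P →
            ∃ λ v → P v × (∀ w → w ≺ v → ¬ P w)
  minimal {P} P? (x , p) = go x p (<-wellFounded (height x))
    where
    go : ∀ x → P x → Acc _<_ (height x) → ∃ λ v → P v × (∀ w → w ≺ v → ¬ P w)
    go x p (acc rs) with any? (λ w → (w ≺? x) ×-dec P? w)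
    ... | yes (w , l@(w≼x , w≢x) , q) = go w q (rs (height-mono w≼x w≢x))
    ... | no ¬∃ = x , p , λ w l q → ¬∃ (w , l , q)

  Sib-refl : ∀ {x} → Sib x x
  Sib-refl z = id , id

  Sib-sym : ∀ {x y} → Sib x y → Sib y x
  Sib-sym s z = proj₂ (s z) , proj₁ (s z)

  Sib-trans : ∀ {x y z} → Sib x y → Sib y z → Sib x z
  Sib-trans s t w = proj₁ (t w) ∘ proj₁ (s w) , proj₂ (s w) ∘ proj₂ (t w)

  SameU-refl : ∀ {x} → SameU x x
  SameU-refl a = id , id

  SameU-sym : ∀ {x y} → SameU x y → SameU y x
  SameU-sym s z = proj₂ (s z) , proj₁ (s z)

  SameU-trans : ∀ {x y z} → SameU x y → SameU y z → SameU x z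
  SameU-trans s t w = proj₁ (t w) ∘ proj₁ (s w) , proj₂ (s w) ∘ proj₂ (t w)

  -- A strict `x ≺ y` would carry over to `x ≺ x` by siblinghood. Hence distinct siblings head
  -- disjoint subtrees.
  Sib-≼⇒≡ : ∀ {x y} → Sib x y → x ≼ y → x ≡ y
  Sib-≼⇒≡ {x} {y} s p with x ≟ y
  ... | yes e = e
  ... | no e = contradiction refl (proj₂ (proj₂ (s x) (p , e)))

  -- Siblinghood places both witnesses above `x`, so they are comparable, and the upper one
  -- witnesses the composite. They differ because `w` is in the set of `y` and `v` is not.
  Lex-trans : ∀ {x y z} → Sib x y → Lex x y → Lex y z → Lex x z
  Lex-trans s (v , (xv , ¬yv) , eq) (w , (yw , ¬zw) , eq′)
    with ≼-chain (proj₁ (proj₁ xv)) (proj₁ (proj₂ (s w) (proj₁ yw)))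
  ... | inj₁ v≼w = v , (xv , λ zv → ¬yv (proj₂ (eq′ v v≺w) zv)) ,
          λ u u≺v → proj₁ (eq′ u (≺-trans u≺v v≺w)) ∘ proj₁ (eq u u≺v) ,
                    proj₂ (eq u u≺v) ∘ proj₂ (eq′ u (≺-trans u≺v v≺w))
    where v≺w = v≼w , λ { refl → ¬yv yw }
  ... | inj₂ w≼v = w , (proj₂ (eq w w≺v) yw , ¬zw) ,
          λ u u≺w → proj₁ (eq′ u u≺w) ∘ proj₁ (eq u (≺-trans u≺w w≺v)) ,
                    proj₂ (eq u (≺-trans u≺w w≺v)) ∘ proj₂ (eq′ u u≺w)
    where w≺v = w≼v , λ { refl → ¬yv yw }

  Lex-respˡ : ∀ {x y z} → SameU x y → Lex y z → Lex x z
  Lex-respˡ s (v , (yv , ¬zv) , eq) = v , (proj₂ (s v) yv , ¬zv) ,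
    λ w l → proj₁ (eq w l) ∘ proj₁ (s w) , proj₂ (s w) ∘ proj₂ (eq w l)

  Lex-respʳ : ∀ {x y z} → Lex x y → SameU y z → Lex x z
  Lex-respʳ (v , (xv , ¬yv) , eq) s = v , (xv , ¬yv ∘ proj₂ (s v)) ,
    λ w l → proj₁ (s w) ∘ proj₁ (eq w l) , proj₂ (eq w l) ∘ proj₂ (s w)

  Lex-total : ∀ x y → SameU x y ⊎ (Lex x y ⊎ Lex y x)
  Lex-total x y with any? (λ v → ¬? (U? x v ⟺-dec U? y v))
  ... | no ¬∃ = inj₁ λ v → decidable-stable (U? x v ⟺-dec U? y v) λ ¬s → ¬∃ (v , ¬s)
  ... | yes ∃d with minimal (λ v → ¬? (U? x v ⟺-dec U? y v)) ∃d
  ...   | v , ¬s , min with U? x v | U? y v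
  ...     | yes xv | yes yv = contradiction ((λ _ → yv) , λ _ → xv) ¬s
  ...     | yes xv | no ¬yv = inj₂ (inj₁ (v , (xv , ¬yv) , λ w l →
                decidable-stable (U? x w ⟺-dec U? y w) (min w l)))
  ...     | no ¬xv | yes yv = inj₂ (inj₂ (v , (yv , ¬xv) , λ w l →
                let s = decidable-stable (U? x w ⟺-dec U? y w) (min w l) in proj₂ s , proj₁ s))
  ...     | no ¬xv | no ¬yv = contradiction ((λ xv → contradiction xv ¬xv) , λ yv → contradiction yv ¬yv) ¬s

  -- Colours break the ties left by `Lex`, so they only have to separate siblings with equal sets
  -- `U`.
  module Coloured
    (col : X → ℕ)
    (col-injective : ∀ {x y} → Sib x y → SameU x y → col x ≡ col y → x ≡ y)
    where

    infix 4 _⊏_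
    _⊏_ : X → X → Set
    x ⊏ y = Sib x y × (Lex x y ⊎ (SameU x y × col x < col y))

    Branch : X → X → Set
    Branch x y = ∃ λ x′ → ∃ λ y′ → (x′ ≼ x × y′ ≼ y) × x′ ⊏ y′

    infix 4 _⊑_
    -- The preorder traversal of the forest: ancestors first, siblings visited in the order `⊏`.
    _⊑_ : X → X → Set
    x ⊑ y = x ≼ y ⊎ Branch x y

    ⊏-irrefl : ∀ {x} → ¬ x ⊏ x
    ⊏-irrefl (_ , inj₁ (_ , (u , ¬u) , _)) = ¬u u
    ⊏-irrefl (_ , inj₂ (_ , l)) = ℕ.<-irrefl refl l

    ⊏-trans : ∀ {x y z} → x ⊏ y → y ⊏ z → x ⊏ z
    ⊏-trans (s , k) (t , l) = Sib-trans s t , go k l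
      where
      go : _ → _ → _
      go (inj₁ k) (inj₁ l) = inj₁ (Lex-trans s k l)
      go (inj₁ k) (inj₂ (u , _)) = inj₁ (Lex-respʳ k u)
      go (inj₂ (u , _)) (inj₁ l) = inj₁ (Lex-respˡ u l)
      go (inj₂ (u , k)) (inj₂ (v , l)) = inj₂ (SameU-trans u v , ℕ.<-trans k l)

    ⊏-total : ∀ {x y} → Sib x y → x ≢ y → x ⊏ y ⊎ y ⊏ x
    ⊏-total {x} {y} s e with Lex-total x y
    ... | inj₂ (inj₁ l) = inj₁ (s , inj₁ l)
    ... | inj₂ (inj₂ l) = inj₂ (Sib-sym s , inj₁ l)
    ... | inj₁ u with ℕ.<-cmp (col x) (col y)
    ...   | tri< l _ _ = inj₁ (s , inj₂ (u , l))
    ...   | tri≈ _ c _ = contradiction (col-injective s u c) e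
    ...   | tri> _ _ l = inj₂ (Sib-sym s , inj₂ (SameU-sym u , l))

    -- Both branching points lie above `x`, hence are comparable; comparable siblings coincide,
    -- against irreflexivity of `⊏`.
    Branch-irrefl : ∀ {x} → ¬ Branch x x
    Branch-irrefl (x′ , y′ , (p , q) , r) with ≼-chain p q
    ... | inj₁ l = ⊏-irrefl (subst (_⊏ y′) (Sib-≼⇒≡ (proj₁ r) l) r)
    ... | inj₂ l = ⊏-irrefl (subst (x′ ⊏_) (Sib-≼⇒≡ (Sib-sym (proj₁ r)) l) r)

    -- If the branching point `y′` is at or above `x`, the same branch serves `x`; otherwise `x` is
    -- a proper ancestor of `y′`, hence of its sibling `z′`, hence of `z`.
    ≼-Branch : ∀ {x y z} → x ≼ y → Branch y z → x ⊑ z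
    ≼-Branch p (y′ , z′ , (q , r) , l) with ≼⊎≻ q p
    ... | inj₁ y′≼x = inj₂ (y′ , z′ , (y′≼x , r) , l)
    ... | inj₂ x≺y′ = inj₁ (≼-trans (proj₁ (proj₁ (proj₁ l _) x≺y′)) r)

    Branch-≼ : ∀ {x y z} → Branch x y → y ≼ z → Branch x z
    Branch-≼ (x′ , y′ , (q , r) , l) p = x′ , y′ , (q , ≼-trans r p) , l

    -- The two branching points above `y` lie on one chain. If they coincide, `⊏` composes;
    -- otherwise the upper one already separates `x` from `z`.
    Branch-trans : ∀ {x y z} → Branch x y → Branch y z → Branch x z
    Branch-trans (x₁ , y₁ , (p , q) , k) (y₂ , z₂ , (r , s) , l) with y₁ ≟ y₂
    ... | yes refl = x₁ , z₂ , (p , s) , ⊏-trans k l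
    ... | no e with ≼-chain q r
    ...   | inj₁ y₁≼y₂ = x₁ , y₁ , (p , ≼-trans (proj₁ (proj₁ (proj₁ l y₁) (y₁≼y₂ , e))) s) , k
    ...   | inj₂ y₂≼y₁ = y₂ , z₂ , (≼-trans (proj₁ (proj₂ (proj₁ k y₂) (y₂≼y₁ , e ∘ ≡-sym))) p , s) , l

    ⊑-antisym : ∀ {x y} → x ⊑ y → y ⊑ x → x ≡ y
    ⊑-antisym (inj₁ p) (inj₁ q) = ≼-antisym p q
    ⊑-antisym (inj₁ p) (inj₂ q) = ⊥-elim (Branch-irrefl (Branch-≼ q p))
    ⊑-antisym (inj₂ p) (inj₁ q) = ⊥-elim (Branch-irrefl (Branch-≼ p q))
    ⊑-antisym (inj₂ p) (inj₂ q) = ⊥-elim (Branch-irrefl (Branch-trans p q))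

    ⊑-trans : ∀ {x y z} → x ⊑ y → y ⊑ z → x ⊑ z
    ⊑-trans (inj₁ p) (inj₁ q) = inj₁ (≼-trans p q)
    ⊑-trans (inj₁ p) (inj₂ q) = ≼-Branch p q
    ⊑-trans (inj₂ p) (inj₁ q) = inj₂ (Branch-≼ p q)
    ⊑-trans (inj₂ p) (inj₂ q) = inj₂ (Branch-trans p q)

    firstOutside : ∀ {x y} → ¬ x ≼ y → ∃ λ x′ → (x′ ≼ x × ¬ x′ ≼ y) × (∀ z → z ≺ x′ → z ≼ y)
    firstOutside {x} {y} x⋠y
      with minimal (λ v → (v ≼? x) ×-dec ¬? (v ≼? y)) (x , ≼-refl , x⋠y)
    ... | x′ , (p , q) , min = x′ , (p , q) , λ z l →
            decidable-stable (z ≼? y) λ z⋠y → min z l (≼-trans (proj₁ l) p , z⋠y)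

    -- The proper ancestors of `x′`, and likewise of `y′`, are exactly the common ancestors of `x`
    -- and `y`.
    Sib-firstOutside : ∀ {x y x′ y′} →
      (x′ ≼ x × ¬ x′ ≼ y) × (∀ z → z ≺ x′ → z ≼ y) →
      (y′ ≼ y × ¬ y′ ≼ x) × (∀ z → z ≺ y′ → z ≼ x) → Sib x′ y′
    Sib-firstOutside p q z = below p q z , below q p z
      where
      below : ∀ {x y x′ y′} →
        (x′ ≼ x × ¬ x′ ≼ y) × (∀ z → z ≺ x′ → z ≼ y) →
        (y′ ≼ y × ¬ y′ ≼ x) × (∀ z → z ≺ y′ → z ≼ x) → ∀ z → z ≺ x′ → z ≺ y′
      below ((x′≼x , _) , minx) ((y′≼y , y′⋠x) , _) z l with ≼⊎≻ y′≼y (minx z l)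
      ... | inj₁ y′≼z = contradiction (≼-trans y′≼z (≼-trans (proj₁ l) x′≼x)) y′⋠x
      ... | inj₂ z≺y′ = z≺y′

    ⊑-total : ∀ x y → x ⊑ y ⊎ y ⊑ x
    ⊑-total x y with x ≼? y | y ≼? x
    ... | yes p | _ = inj₁ (inj₁ p)
    ... | no _ | yes q = inj₂ (inj₁ q)
    ... | no x⋠y | no y⋠x with firstOutside x⋠y | firstOutside y⋠x
    ...   | x′ , o@((x′≼x , x′⋠y) , _) | y′ , o′@((y′≼y , _) , _)
            with ⊏-total (Sib-firstOutside o o′) (λ { refl → x′⋠y y′≼y })
    ...     | inj₁ r = inj₁ (inj₂ (x′ , y′ , (x′≼x , y′≼y) , r))
    ...     | inj₂ r = inj₂ (inj₂ (y′ , x′ , (y′≼y , x′≼x) , r))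

    ⊑-isLinearOrder : IsLinearOrder _⊑_
    ⊑-isLinearOrder = record
      { refl = λ _ → inj₁ ≼-refl
      ; antisym = λ _ _ → ⊑-antisym
      ; trans = λ _ _ _ → ⊑-trans
      ; total = ⊑-total
      }

-- Depth-first search forests

sum-mono-≤ : ∀ {n} {f g : Fin n → ℕ} → (∀ i → f i ≤ g i) → sum f ≤ sum g
sum-mono-≤ {zero} le = z≤n
sum-mono-≤ {suc n} le = ℕ.+-mono-≤ (le zero) (sum-mono-≤ (le ∘ suc))

sum-mono-< : ∀ {n} {f g : Fin n → ℕ} → (∀ i → f i ≤ g i) → ∀ j → f j < g j → sum f < sum g
sum-mono-< le zero lt = ℕ.+-mono-<-≤ lt (sum-mono-≤ (le ∘ suc))
sum-mono-< le (suc j) lt = ℕ.+-mono-≤-< (le zero) (sum-mono-< (le ∘ suc) j lt)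

-- A spanning forest whose tree edges are edges of `G`; `child-depth` excludes cycles of parents.
record Forest (G : Graph) : Set where
  field
    parent      : Vertex G → Maybe (Vertex G)
    depth       : Vertex G → ℕ
    root-depth  : ∀ {v} → parent v ≡ nothing → depth v ≡ 0
    child-adj   : ∀ {u v} → parent v ≡ just u → adj G u v ≡ true
    child-depth : ∀ {u v} → parent v ≡ just u → depth v ≡ suc (depth u)

module _ {G : Graph} (F : Forest G) where
  open Forest F

  data Anc : Vertex G → Vertex G → Set where
    self  : ∀ {v} → Anc v v
    above : ∀ {a u v} → parent v ≡ just u → Anc a u → Anc a v

  Anc-trans : ∀ {a b c} → Anc a b → Anc b c → Anc a c
  Anc-trans p self = p
  Anc-trans p (above e q) = above e (Anc-trans p q)

  Anc-chain : ∀ {a b c} → Anc a c → Anc b c → Anc a b ⊎ Anc b a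
  Anc-chain self q = inj₂ q
  Anc-chain p self = inj₁ p
  Anc-chain (above e p) (above e′ q) with just-injective (≡-trans (≡-sym e) e′)
  ... | refl = Anc-chain p q

  Anc-depth-≤ : ∀ {a b} → Anc a b → depth a ≤ depth b
  Anc-depth-≤ self = ℕ.≤-refl
  Anc-depth-≤ (above e p) = subst (depth _ ≤_) (≡-sym (child-depth e)) (ℕ.m≤n⇒m≤1+n (Anc-depth-≤ p))

  Anc-depth-< : ∀ {a b} → Anc a b → a ≢ b → depth a < depth b
  Anc-depth-< self ne = contradiction refl ne
  Anc-depth-< (above e p) _ = subst (depth _ <_) (≡-sym (child-depth e)) (s≤s (Anc-depth-≤ p))

  Anc? : ∀ a v → Dec (Anc a v)
  Anc? a v = go (depth v) v ℕ.≤-refl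
    where
    go : ∀ k v → depth v ≤ k → Dec (Anc a v)
    go k v le with a Fin.≟ v | parent v in eq
    ... | yes refl | _ = yes self
    ... | no ne | nothing = no λ { self → ne refl ; (above e _) → contradiction (≡-trans (≡-sym eq) e) λ () }
    ... | no ne | just u with subst (_≤ k) (child-depth eq) le
    go (suc k) v _ | no ne | just u | s≤s le = map′ (above eq) down (go k u le)
      where
      down : Anc a v → Anc a u
      down self = contradiction refl ne
      down (above e p) with just-injective (≡-trans (≡-sym eq) e)
      ... | refl = p

  ∃-depth : ∀ v i → i ≤ depth v → ∃ λ a → depth a ≡ i
  ∃-depth v i le = go (depth v) v refl le
    where
    go : ∀ k v → depth v ≡ k → i ≤ k → ∃ λ a → depth a ≡ i
    go k v dv le with i ℕ.≟ k
    ... | yes refl = v , dv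
    ... | no ne with parent v in eq
    go zero v dv z≤n | no ne | _ = contradiction refl ne
    go (suc k) v dv le | no ne | nothing = contradiction (≡-trans (≡-sym (root-depth eq)) dv) λ ()
    go (suc k) v dv le | no ne | just u =
      go k u (ℕ.suc-injective (≡-trans (≡-sym (child-depth eq)) dv)) (ℕ.≤-pred (ℕ.≤∧≢⇒< le ne))

  -- Climbing skips no level, so each of the levels 0 to `depth v` contains a vertex, and these
  -- vertices are distinct.
  depth<n : ∀ v → depth v < n G
  depth<n v = Fin.injective⇒≤ {f = level} λ {i} {j} e → Fin.toℕ-injective
    (≡-trans (≡-sym (depth-level i)) (≡-trans (cong depth e) (depth-level j)))
    where
    level : Fin (suc (depth v)) → Vertex G
    level i = proj₁ (∃-depth v (toℕ i) (Fin.toℕ≤pred[n] i))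
    depth-level : ∀ i → depth (level i) ≡ toℕ i
    depth-level i = proj₂ (∃-depth v (toℕ i) (Fin.toℕ≤pred[n] i))

  -- Termination measure for the search: it falls as vertices sink deeper.
  slack : ℕ
  slack = sum λ v → n G ∸ depth v

  Normal : Set
  Normal = ∀ {u v} → adj G u v ≡ true → Anc u v ⊎ Anc v u

-- The subtree of `y` is cut off and hung below `x`. No cycle arises since `y` is not above `x`, and
-- no depth decreases since `y` was no deeper than `x`.
module _ {G : Graph} (F : Forest G) {x y : Vertex G} (x~y : adj G x y ≡ true)
         (y≰x : ¬ Anc F y x) (dy≤dx : Forest.depth F y ≤ Forest.depth F x) where
  open Forest F

  private
    -- The whole moved subtree sinks by the amount that makes `y` a child of `x`.
    δ = suc (depth x) ∸ depth y

    parent′ : Vertex G → Maybe (Vertex G)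
    parent′ z with z Fin.≟ y
    ... | yes _ = just x
    ... | no _ = parent z

    depth′ : Vertex G → ℕ
    depth′ z with Anc? F y z
    ... | yes _ = depth z + δ
    ... | no _ = depth z

    depth′-below : ∀ {z} → Anc F y z → depth′ z ≡ depth z + δ
    depth′-below {z} p with Anc? F y z
    ... | yes _ = refl
    ... | no ¬p = contradiction p ¬p

    depth′-rest : ∀ {z} → ¬ Anc F y z → depth′ z ≡ depth z
    depth′-rest {z} ¬p with Anc? F y z
    ... | yes p = contradiction p ¬p
    ... | no _ = refl

    depth′-y : depth′ y ≡ suc (depth x)
    depth′-y = ≡-trans (depth′-below self) (ℕ.m+[n∸m]≡n (ℕ.m≤n⇒m≤1+n dy≤dx))

    depth-grows : ∀ z → depth z ≤ depth′ z
    depth-grows z with Anc? F y z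
    ... | yes _ = ℕ.m≤m+n _ _
    ... | no _ = ℕ.≤-refl

  reattach : Forest G
  reattach = record
    { parent = parent′ ; depth = depth′ ; root-depth = root′ ; child-adj = adj′ ; child-depth = dep′ }
    where
    root′ : ∀ {v} → parent′ v ≡ nothing → depth′ v ≡ 0
    root′ {v} e with v Fin.≟ y
    root′ {v} () | yes _
    ... | no v≢y = ≡-trans (depth′-rest λ { self → v≢y refl ; (above e′ _) → contradiction (≡-trans (≡-sym e) e′) λ () })
                     (root-depth e)
    adj′ : ∀ {u v} → parent′ v ≡ just u → adj G u v ≡ true
    adj′ {u} {v} e with v Fin.≟ y
    adj′ refl | yes refl = x~y
    ... | no _ = child-adj e
    dep′ : ∀ {u v} → parent′ v ≡ just u → depth′ v ≡ suc (depth′ u)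
    dep′ {u} {v} e with v Fin.≟ y
    dep′ refl | yes refl = ≡-trans depth′-y (cong suc (≡-sym (depth′-rest y≰x)))
    dep′ {u} {v} e | no v≢y with Anc? F y u
    ... | yes p = ≡-trans (depth′-below (above e p)) (cong (_+ δ) (child-depth e))
    ... | no ¬p = ≡-trans (depth′-rest λ { self → v≢y refl ; (above e′ q) → ¬p (subst (Anc F y) (just-injective (≡-trans (≡-sym e′) e)) q) })
                    (child-depth e)

  -- The term of `y` drops strictly. For truncated subtraction this requires the depth bound in the
  -- new forest.
  reattach-slack : slack reattach < slack F
  reattach-slack = sum-mono-< (λ v → ℕ.∸-monoʳ-≤ (n G) (depth-grows v)) y
    (ℕ.∸-monoʳ-< (subst (depth y <_) (≡-sym depth′-y) (s≤s dy≤dx)) (ℕ.<⇒≤ (depth<n reattach y)))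

discreteForest : (G : Graph) → Forest G
discreteForest G = record
  { parent = λ _ → nothing ; depth = λ _ → 0 ; root-depth = λ _ → refl
  ; child-adj = λ () ; child-depth = λ () }

-- A forest whose depths cannot be increased by reattaching a subtree is a
-- depth-first search forest.
normalForest : (G : Graph) → Σ (Forest G) Normal
normalForest G = go (discreteForest G) (<-wellFounded _)
  where
  crossing? : (F : Forest G) → Dec (∃ λ x → ∃ λ y → adj G x y ≡ true × ¬ Anc F x y × ¬ Anc F y x)
  crossing? F = Fin.any? λ x → Fin.any? λ y →
    (adj G x y Bool.≟ true) ×-dec ¬? (Anc? F x y) ×-dec ¬? (Anc? F y x)
  go : (F : Forest G) → Acc _<_ (slack F) → Σ (Forest G) Normal
  go F (acc rs) with crossing? F
  ... | no ¬∃ = F , normal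
    where
    normal : Normal F
    normal {u} {v} a with Anc? F u v | Anc? F v u
    ... | yes p | _ = inj₁ p
    ... | no _ | yes q = inj₂ q
    ... | no ¬p | no ¬q = ⊥-elim (¬∃ (u , v , a , ¬p , ¬q))
  ... | yes (x , y , a , x≰y , y≰x) with ℕ.≤-total (Forest.depth F y) (Forest.depth F x)
  ...   | inj₁ le = go (reattach F a y≰x le) (rs (reattach-slack F a y≰x le))
  ...   | inj₂ le = go (reattach F a′ x≰y le) (rs (reattach-slack F a′ x≰y le))
    where a′ = ≡-trans (Graph.sym G y x) a

-- The forest order on vertices and edges

module _ (G : Graph) where

  IsEdge : Vertex G → Vertex G → Set
  IsEdge i j = toℕ i < toℕ j × adj G i j ≡ true

  IsEdge? : ∀ i j → Dec (IsEdge i j)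
  IsEdge? i j = (toℕ i ℕ.<? toℕ j) ×-dec (adj G i j Bool.≟ true)

  Edge-≡ : {e f : Edge G} → proj₁ e ≡ proj₁ f → e ≡ f
  Edge-≡ {ij , p , q} {_ , p′ , q′} refl = cong (ij ,_) (cong₂ _,_ (ℕ.<-irrelevant p p′) (uip q q′))

  _≟ₑ_ : (a b : Elem G) → Dec (a ≡ b)
  _≟ₑ_ = ⊎-≡-dec Fin._≟_ λ e f → map′ Edge-≡ (cong proj₁) (×-≡-dec Fin._≟_ Fin._≟_ (proj₁ e) (proj₁ f))

  anyElem? : Searchable (Elem G)
  anyElem? {P} P? = map′ from to (Fin.any? (P? ∘ inj₁) ⊎-dec Fin.any? λ i → Fin.any? λ j → edge? i j)
    where
    EdgeP : Vertex G → Vertex G → Set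
    EdgeP i j = Σ (IsEdge i j) λ q → P (inj₂ ((i , j) , q))
    edge? : ∀ i j → Dec (EdgeP i j)
    edge? i j with IsEdge? i j
    ... | no ¬q = no (¬q ∘ proj₁)
    ... | yes q = map′ (q ,_) (λ (_ , x) → subst P (cong inj₂ (Edge-≡ refl)) x) (P? (inj₂ ((i , j) , q)))
    from : (∃ (P ∘ inj₁) ⊎ ∃ λ i → ∃ (EdgeP i)) → ∃ P
    from (inj₁ (v , p)) = inj₁ v , p
    from (inj₂ (i , j , q , p)) = inj₂ ((i , j) , q) , p
    to : ∃ P → ∃ (P ∘ inj₁) ⊎ ∃ λ i → ∃ (EdgeP i)
    to (inj₁ v , p) = inj₁ (v , p)
    to (inj₂ ((i , j) , q) , p) = inj₂ (i , j , q , p)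

  Inc? : ∀ a b → Dec (Inc G a b)
  Inc? (inj₁ v) (inj₁ _) = no λ ()
  Inc? (inj₁ v) (inj₂ ((i , j) , _)) = (v Fin.≟ i) ⊎-dec (v Fin.≟ j)
  Inc? (inj₂ _) _ = no λ ()

  adj⇒edge : ∀ {u v} → adj G u v ≡ true → ∃ λ e → Inc G (inj₁ u) (inj₂ e) × Inc G (inj₁ v) (inj₂ e)
  adj⇒edge {u} {v} a with ℕ.<-cmp (toℕ u) (toℕ v)
  ... | tri< l _ _ = ((u , v) , l , a) , inj₁ refl , inj₂ refl
  ... | tri> _ _ l = ((v , u) , l , ≡-trans (Graph.sym G v u) a) , inj₂ refl , inj₁ refl
  ... | tri≈ _ e _ with Fin.toℕ-injective e
  ...   | refl = contradiction (≡-trans (≡-sym a) (irrefl G u)) λ ()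

  -- The two ends of `e` are distinct, so they exhaust the ends of `f`; the convention `i < j` fixes
  -- their order.
  Inc-⊆⇒≡ : ∀ {e f} → (∀ u → Inc G (inj₁ u) (inj₂ e) → Inc G (inj₁ u) (inj₂ f)) → e ≡ f
  Inc-⊆⇒≡ {(i , j) , i<j , _} {f@((k , l) , k<l , _)} sub = Edge-≡ (go (sub i (inj₁ refl)) (sub j (inj₂ refl)))
    where
    go : Inc G (inj₁ i) (inj₂ f) → Inc G (inj₁ j) (inj₂ f) → (i , j) ≡ (k , l)
    go (inj₁ refl) (inj₁ refl) = contradiction i<j (ℕ.<-irrefl refl)
    go (inj₁ refl) (inj₂ refl) = refl
    go (inj₂ refl) (inj₁ refl) = contradiction i<j (ℕ.<-asym k<l)
    go (inj₂ refl) (inj₂ refl) = contradiction i<j (ℕ.<-irrefl refl)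

module ElemOrder {G : Graph} (F : Forest G) (normal : Normal F) where
  open Forest F

  -- Normality orients every edge of `G`, tree edge or not, from ancestor to descendant.
  record Ends (e : Edge G) : Set where
    field
      upper lower : Vertex G
      upper-inc   : Inc G (inj₁ upper) (inj₂ e)
      lower-inc   : Inc G (inj₁ lower) (inj₂ e)
      upper-anc   : Anc F upper lower
      ends-adj    : adj G upper lower ≡ true
      ends-only   : ∀ {u} → Inc G (inj₁ u) (inj₂ e) → u ≡ upper ⊎ u ≡ lower

  ends : ∀ e → Ends e
  ends ((i , j) , i<j , a) with normal a
  ... | inj₁ p = record { upper = i ; lower = j ; upper-inc = inj₁ refl ; lower-inc = inj₂ refl
                        ; upper-anc = p ; ends-adj = a ; ends-only = id }
  ... | inj₂ p = record { upper = j ; lower = i ; upper-inc = inj₂ refl ; lower-inc = inj₁ refl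
                        ; upper-anc = p ; ends-adj = ≡-trans (Graph.sym G j i) a ; ends-only = Sum.swap }

  module _ (e : Edge G) where
    open Ends (ends e) public

  Anc-≡⊎< : ∀ {u v} → Anc F u v → u ≡ v ⊎ depth u < depth v
  Anc-≡⊎< {u} {v} p with u Fin.≟ v
  ... | yes e = inj₁ e
  ... | no ne = inj₂ (Anc-depth-< F p ne)

  Anc-antisym : ∀ {u v} → Anc F u v → Anc F v u → u ≡ v
  Anc-antisym p q with Anc-≡⊎< p
  ... | inj₁ e = e
  ... | inj₂ l = contradiction (Anc-depth-≤ F q) (ℕ.<⇒≱ l)

  adj⇒≢ : ∀ {u v} → adj G u v ≡ true → u ≢ v
  adj⇒≢ a refl = contradiction (≡-trans (≡-sym a) (irrefl G _)) λ ()

  Inc⇒Anc-lower : ∀ {u} e → Inc G (inj₁ u) (inj₂ e) → Anc F u (lower e)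
  Inc⇒Anc-lower e i with ends-only e i
  ... | inj₁ refl = upper-anc e
  ... | inj₂ refl = self

  adj⇒ends : ∀ {u v} → adj G u v ≡ true → Anc F u v → ∃ λ e → upper e ≡ u × lower e ≡ v
  adj⇒ends {u} {v} a p with adj⇒edge G a
  ... | e , i , j with ends-only e i | ends-only e j
  ...   | inj₁ r | inj₂ s = e , ≡-sym r , ≡-sym s
  ...   | inj₁ r | inj₁ s = contradiction (≡-trans r (≡-sym s)) (adj⇒≢ a)
  ...   | inj₂ r | inj₂ s = contradiction (≡-trans r (≡-sym s)) (adj⇒≢ a)
  ...   | inj₂ refl | inj₁ refl = contradiction (Anc-antisym p (upper-anc e)) (adj⇒≢ a)

  infix 4 _≼_
  -- Each edge hangs as a leaf below its lower end, which extends the forest to all elements.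
  _≼_ : Elem G → Elem G → Set
  inj₁ u ≼ inj₁ v = Anc F u v
  inj₁ u ≼ inj₂ e = Anc F u (lower e)
  inj₂ e ≼ inj₁ v = ⊥
  inj₂ e ≼ inj₂ f = e ≡ f

  _≼?_ : ∀ a b → Dec (a ≼ b)
  inj₁ u ≼? inj₁ v = Anc? F u v
  inj₁ u ≼? inj₂ e = Anc? F u (lower e)
  inj₂ e ≼? inj₁ v = no λ ()
  inj₂ e ≼? inj₂ f = map′ (λ { refl → refl }) (cong inj₂) (_≟ₑ_ G (inj₂ e) (inj₂ f))

  ≼-refl : ∀ {a} → a ≼ a
  ≼-refl {inj₁ v} = self
  ≼-refl {inj₂ e} = refl

  ≼-trans : ∀ {a b c} → a ≼ b → b ≼ c → a ≼ c
  ≼-trans {inj₁ _} {inj₁ _} {inj₁ _} p q = Anc-trans F p q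
  ≼-trans {inj₁ _} {inj₁ _} {inj₂ _} p q = Anc-trans F p q
  ≼-trans {inj₁ _} {inj₂ _} {inj₂ _} p refl = p
  ≼-trans {inj₂ _} {inj₂ _} {inj₂ _} refl refl = refl

  ≼-chain : ∀ {a b c} → a ≼ c → b ≼ c → a ≼ b ⊎ b ≼ a
  ≼-chain {inj₁ _} {inj₁ _} {inj₁ _} p q = Anc-chain F p q
  ≼-chain {inj₁ _} {inj₁ _} {inj₂ _} p q = Anc-chain F p q
  ≼-chain {inj₁ _} {inj₂ _} {inj₂ _} p refl = inj₁ p
  ≼-chain {inj₂ _} {inj₁ _} {inj₂ _} refl q = inj₂ q
  ≼-chain {inj₂ _} {inj₂ _} {inj₂ _} refl refl = inj₁ refl

  height : Elem G → ℕ
  height (inj₁ v) = depth v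
  height (inj₂ e) = suc (depth (lower e))

  height-mono : ∀ {a b} → a ≼ b → a ≢ b → height a < height b
  height-mono {inj₁ _} {inj₁ _} p ne = Anc-depth-< F p (ne ∘ cong inj₁)
  height-mono {inj₁ _} {inj₂ _} p ne = s≤s (Anc-depth-≤ F p)
  height-mono {inj₂ _} {inj₂ _} refl ne = contradiction refl ne

  open ForestOrder (anyElem? G) (_≟ₑ_ G) _≼_ _≼?_ (λ {a} → ≼-refl {a}) (λ {a} {b} {c} → ≼-trans {a} {b} {c})
    (λ {a} {b} {c} → ≼-chain {a} {b} {c}) height (λ {a} {b} → height-mono {a} {b}) (Inc G) (Inc? G) public
    hiding (≼-antisym)

  parity : ℕ → Bool
  parity zero = true
  parity (suc k) = not (parity k)

  -- Equality of marks at the incidence of v and e forces v to be the lower end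
  -- of e, so the marking orients the edges of the forest.
  mark : Elem G → Bool
  mark (inj₁ v) = parity (depth v)
  mark (inj₂ e) = not (parity (depth (upper e)))

  mark-≡⇒lower : ∀ {v} e → Inc G (inj₁ v) (inj₂ e) → mark (inj₂ e) ≡ mark (inj₁ v) → v ≡ lower e
  mark-≡⇒lower e i m with ends-only e i
  ... | inj₁ refl = contradiction (≡-sym m) (Bool.not-¬ refl)
  ... | inj₂ r = r

  -- Depth grows by exactly one along a tree edge, so the negated parity at the upper end is the
  -- parity at the lower end.
  tree-edge : ∀ {u v} → parent v ≡ just u →
    ∃ λ e → Inc G (inj₁ u) (inj₂ e) × Inc G (inj₁ v) (inj₂ e) × mark (inj₂ e) ≡ mark (inj₁ v)
  tree-edge q with adj⇒ends (child-adj q) (above q self)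
  ... | e , refl , refl = e , upper-inc e , lower-inc e , cong parity (≡-sym (child-depth q))

-- Colouring siblings

does-true⇒ : {A : Set} (a? : Dec A) → does a? ≡ true → A
does-true⇒ (yes a) _ = a

does-⟺ : {A B : Set} → A ⟺ B → (a? : Dec A) (b? : Dec B) → does a? ≡ does b?
does-⟺ _ (yes _) (yes _) = refl
does-⟺ _ (no _) (no _) = refl
does-⟺ (f , _) (yes a) (no ¬b) = contradiction (f a) ¬b
does-⟺ (_ , g) (no ¬a) (yes b) = contradiction (g b) ¬a

module _ {n : ℕ} where

  ⟪_⟫ : {P : Fin n → Set} → (∀ i → Dec (P i)) → Subset n
  ⟪ P? ⟫ = tabulate (does ∘ P?)

  ∈⟪⟫⁺ : {P : Fin n → Set} (P? : ∀ i → Dec (P i)) → ∀ {i} → P i → i ∈ ⟪ P? ⟫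
  ∈⟪⟫⁺ P? {i} p = lookup⇒[]= i _ (≡-trans (lookup∘tabulate (does ∘ P?) i) (dec-true (P? i) p))

  ∈⟪⟫⁻ : {P : Fin n → Set} (P? : ∀ i → Dec (P i)) → ∀ {i} → i ∈ ⟪ P? ⟫ → P i
  ∈⟪⟫⁻ P? {i} m = does-true⇒ (P? i) (≡-trans (≡-sym (lookup∘tabulate (does ∘ P?) i)) ([]=⇒lookup m))

  ⟪⟫-cong : {P Q : Fin n → Set} (P? : ∀ i → Dec (P i)) (Q? : ∀ i → Dec (Q i)) →
            (∀ i → P i ⟺ Q i) → ⟪ P? ⟫ ≡ ⟪ Q? ⟫
  ⟪⟫-cong P? Q? eq = tabulate-cong λ i → does-⟺ (eq i) (P? i) (Q? i)

-- Enumeration of finite subsets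

nth : ∀ {n} (S : Subset n) → Fin ∣ S ∣ → Fin n
nth (true ∷ S) zero = zero
nth (true ∷ S) (suc i) = suc (nth S i)
nth (false ∷ S) i = suc (nth S i)

nth-∈ : ∀ {n} (S : Subset n) i → nth S i ∈ S
nth-∈ (true ∷ S) zero = here
nth-∈ (true ∷ S) (suc i) = there (nth-∈ S i)
nth-∈ (false ∷ S) i = there (nth-∈ S i)

nth-injective : ∀ {n} (S : Subset n) {i j} → nth S i ≡ nth S j → i ≡ j
nth-injective (true ∷ S) {zero} {zero} _ = refl
nth-injective (true ∷ S) {suc i} {suc j} e = cong suc (nth-injective S (Fin.suc-injective e))
nth-injective (false ∷ S) e = nth-injective S (Fin.suc-injective e)

rank : ∀ {n} {S : Subset n} {x} → x ∈ S → Fin ∣ S ∣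
rank here = zero
rank {S = true ∷ _} (there m) = suc (rank m)
rank {S = false ∷ _} (there m) = rank m

nth-rank : ∀ {n} {S : Subset n} {x} (m : x ∈ S) → nth S (rank m) ≡ x
nth-rank here = refl
nth-rank {S = true ∷ _} (there m) = cong suc (nth-rank m)
nth-rank {S = false ∷ _} (there m) = cong suc (nth-rank m)

rank-injective : ∀ {n} {S T : Subset n} → S ≡ T → ∀ {x y} (m : x ∈ S) (l : y ∈ T) →
                 toℕ (rank m) ≡ toℕ (rank l) → x ≡ y
rank-injective {S = S} refl m l e =
  ≡-trans (≡-sym (nth-rank m)) (≡-trans (cong (nth S) (Fin.toℕ-injective e)) (nth-rank l))

module _ {G : Graph} (F : Forest G) (normal : Normal F) where
  open Forest F
  open ElemOrder F normal

  -- The complete bipartite minor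

  module _ {p : ℕ} (g y : Fin p → Vertex G)
           (g-injective : ∀ {i j} → g i ≡ g j → i ≡ j)
           (y-antichain : ∀ {i j} → Anc F (y i) (y j) → i ≡ j)
           (g∈U : ∀ i j → U (inj₁ (y j)) (inj₁ (g i))) where

    private
      BranchSet : Fin p ⊎ Fin p → Vertex G → Set
      BranchSet (inj₁ i) v = g i ≡ v
      BranchSet (inj₂ j) v = Anc F (y j) v

      y≰g : ∀ i j → ¬ Anc F (y j) (g i)
      y≰g i j a with g∈U i j
      ... | (b , ne) , _ = ne (cong inj₁ (Anc-antisym b a))

      disjoint : ∀ s t {v} → BranchSet s v → BranchSet t v → s ≡ t
      disjoint (inj₁ i) (inj₁ j) e e′ = cong inj₁ (g-injective (≡-trans e (≡-sym e′)))
      disjoint (inj₁ i) (inj₂ j) refl a = ⊥-elim (y≰g i j a)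
      disjoint (inj₂ j) (inj₁ i) a refl = ⊥-elim (y≰g i j a)
      disjoint (inj₂ i) (inj₂ j) a b with Anc-chain F a b
      ... | inj₁ l = cong inj₂ (y-antichain l)
      ... | inj₂ l = cong inj₂ (≡-sym (y-antichain l))

      branch? : ∀ v → Dec (∃ λ s → BranchSet s v)
      branch? v = map′ (λ { (inj₁ (i , e)) → inj₁ i , e ; (inj₂ (j , a)) → inj₂ j , a })
                       (λ { (inj₁ i , e) → inj₁ (i , e) ; (inj₂ j , a) → inj₂ (j , a) })
                       (Fin.any? (λ i → g i Fin.≟ v) ⊎-dec Fin.any? (λ j → Anc? F (y j) v))

      β : Vertex G → Maybe (Fin (p + p))
      β v with branch? v
      ... | yes (s , _) = just (join p p s)
      ... | no _ = nothing

      β⁺ : ∀ {h s v} → splitAt p h ≡ s → BranchSet s v → β v ≡ just h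
      β⁺ {h} {s} {v} refl b with branch? v
      ... | yes (t , b′) = cong just (≡-trans (cong (join p p) (disjoint t s b′ b)) (Fin.join-splitAt p p h))
      ... | no ¬b = contradiction (s , b) ¬b

      β⁻ : ∀ {h s v} → splitAt p h ≡ s → β v ≡ just h → BranchSet s v
      β⁻ {v = v} refl e with branch? v
      β⁻ {v = v} refl refl | yes (t , b) = subst (λ s → BranchSet s v) (≡-sym (Fin.splitAt-join p p t)) b

      -- Inside a subtree the path climbs from `u` to the root `y j` and then descends to `v`.
      connected : ∀ h u v → β u ≡ just h → β v ≡ just h → ConnectedIn G β h u v
      connected h u v eu ev = go (splitAt p h) refl
        where
        go : ∀ s → splitAt p h ≡ s → ConnectedIn G β h u v
        go (inj₁ i) q with β⁻ q eu | β⁻ q ev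
        ... | refl | refl = here eu
        go (inj₂ j) q = down (β⁻ q ev)
          where
          up : ∀ {w} → Anc F (y j) w → ConnectedIn G β h w (y j)
          up self = here (β⁺ q self)
          up a@(above e b) = step (β⁺ q a) (≡-trans (Graph.sym G _ _) (child-adj e)) (up b)
          snoc : ∀ {a b c} → ConnectedIn G β h a b → adj G b c ≡ true → β c ≡ just h → ConnectedIn G β h a c
          snoc (here e) l e′ = step e l (here e′)
          snoc (step e l′ r) l e′ = step e l′ (snoc r l e′)
          down : ∀ {w} → Anc F (y j) w → ConnectedIn G β h u w
          down self = up (β⁻ q eu)
          down a@(above e b) = snoc (down b) (child-adj e) (β⁺ q a)

      -- The edge witnessing membership in `U` has its lower end below `y j`. Since `g i` is not
      -- below `y j`, it is the upper end.
      g-adj : ∀ i j → ∃ λ v → Anc F (y j) v × adj G (g i) v ≡ true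
      g-adj i j with g∈U i j
      ... | _ , inj₂ e , a , q with ends-only e q
      ...   | inj₁ r = lower e , a , subst (λ u → adj G u (lower e) ≡ true) (≡-sym r) (ends-adj e)
      ...   | inj₂ r = ⊥-elim (y≰g i j (subst (Anc F (y j)) (≡-sym r) a))

      nonempty : ∀ h → Σ (Vertex G) λ v → β v ≡ just h
      nonempty h with splitAt p h in q
      ... | inj₁ i = g i , β⁺ q refl
      ... | inj₂ j = y j , β⁺ q self

      edges : ∀ h h′ → adj (K p p) h h′ ≡ true → Σ (Vertex G) λ u → Σ (Vertex G) λ v →
              (β u ≡ just h) × (β v ≡ just h′) × (adj G u v ≡ true)
      edges h h′ k with splitAt p h in q | splitAt p h′ in q′
      ... | inj₁ i | inj₂ j with g-adj i j
      ...   | v , a , l = g i , v , β⁺ q refl , β⁺ q′ a , l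
      edges h h′ k | inj₂ j | inj₁ i with g-adj i j
      ...   | v , a , l = v , g i , β⁺ q a , β⁺ q′ refl , ≡-trans (Graph.sym G _ _) l
      edges h h′ () | inj₁ i | inj₁ j
      edges h h′ () | inj₂ i | inj₂ j

    K-minor : IsMinor (K p p) G
    K-minor = β , nonempty , connected , edges

  -- By normality, an edge leaving the subtree of `x` ends in a proper ancestor of `x`, which then
  -- belongs to the set `U` of `x` and hence to `S`.
  stays-below : ∀ {S : Subset (n G)} {x u v} → (∀ {a} → U (inj₁ x) (inj₁ a) → a ∈ S) →
                ConnectedAvoiding G S u v → Anc F x u → Anc F x v
  stays-below U⊆S (here _) a = a
  stays-below {S} {x} U⊆S (step {u} {v} _ l c) a = stays-below U⊆S c x≤v
    where
    avoids : ∀ {v w} → ConnectedAvoiding G S v w → v ∉ S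
    avoids (here m) = m
    avoids (step m _ _) = m
    x≤v : Anc F x v
    x≤v with normal l
    ... | inj₁ b = Anc-trans F a b
    ... | inj₂ b with Anc-chain F a b | x Fin.≟ v
    ...   | inj₁ r | _ = r
    ...   | inj₂ r | yes refl = self
    ...   | inj₂ r | no ne with adj⇒ends (≡-trans (Graph.sym G v u) l) b
    ...     | e , refl , refl = contradiction
                (U⊆S ((r , λ { refl → ne refl }) , inj₂ e , a , upper-inc e)) (avoids c)

  -- Twin classes and their colours

  U-vertex? : ∀ x a → Dec (U (inj₁ x) (inj₁ a))
  U-vertex? x a = U? (inj₁ x) (inj₁ a)

  Uset : Vertex G → Subset (n G)
  Uset x = ⟪ U-vertex? x ⟫

  x∉Uset : ∀ x → x ∉ Uset x
  x∉Uset x m = proj₂ (proj₁ (∈⟪⟫⁻ (U-vertex? x) m)) refl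

  Uset-cong : ∀ {x y} → SameU (inj₁ x) (inj₁ y) → Uset x ≡ Uset y
  Uset-cong {x} {y} s = ⟪⟫-cong (U-vertex? x) (U-vertex? y) (s ∘ inj₁)

  Twin : Vertex G → Vertex G → Set
  Twin x y = Sib (inj₁ x) (inj₁ y) × SameU (inj₁ x) (inj₁ y)

  Twin? : ∀ x y → Dec (Twin x y)
  Twin? x y = Sib? (inj₁ x) (inj₁ y) ×-dec SameU? (inj₁ x) (inj₁ y)

  Twin-sym : ∀ {x y} → Twin x y → Twin y x
  Twin-sym (s , u) = Sib-sym s , SameU-sym u

  Twin-trans : ∀ {x y z} → Twin x y → Twin y z → Twin x z
  Twin-trans (s , u) (t , v) = Sib-trans s t , SameU-trans u v

  Twins : Vertex G → Subset (n G)
  Twins x = ⟪ Twin? x ⟫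

  x∈Twins : ∀ x → x ∈ Twins x
  x∈Twins x = ∈⟪⟫⁺ (Twin? x) (Sib-refl , SameU-refl)

  Twins-cong : ∀ {x y} → Twin x y → Twins x ≡ Twins y
  Twins-cong {x} {y} t = ⟪⟫-cong (Twin? x) (Twin? y) λ z → Twin-trans (Twin-sym t) , Twin-trans t

  module _ {p d : ℕ} (sep : SepAtMost G p d) (no-minor : ¬ IsMinor (K p p) G) where

    -- Otherwise `p` twins, heading disjoint subtrees, and `p` vertices of their common set `U` give
    -- the excluded minor.
    few-twins : ∀ x → p ≤ ∣ Uset x ∣ → ∣ Twins x ∣ < p
    few-twins x p≤U = ℕ.≰⇒> λ p≤T → no-minor
      (K-minor (nth (Uset x) ∘ λ i → inject≤ i p≤U) (nth (Twins x) ∘ λ i → inject≤ i p≤T)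
        (Fin.inject≤-injective _ _ _ _ ∘ nth-injective (Uset x))
        (λ {i} {j} a → Fin.inject≤-injective _ _ _ _ (nth-injective (Twins x) (twins-antichain (twin p≤T i) (twin p≤T j) a)))
        (λ i j → proj₁ (proj₂ (twin p≤T j) _)
          (∈⟪⟫⁻ (U-vertex? x) (nth-∈ (Uset x) (inject≤ i p≤U)))))
      where
      twin : (p≤T : p ≤ ∣ Twins x ∣) → ∀ j → Twin x (nth (Twins x) (inject≤ j p≤T))
      twin p≤T j = ∈⟪⟫⁻ (Twin? x) (nth-∈ (Twins x) (inject≤ j p≤T))
      twins-antichain : ∀ {y z} → Twin x y → Twin x z → Anc F y z → y ≡ z
      twins-antichain t t′ a with Sib-≼⇒≡ (proj₁ (Twin-trans (Twin-sym t) t′)) a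
      ... | refl = refl

    -- The labelling given by `sep` depends on the set and on the proof of its size bound; equality
    -- of the sets and irrelevance of `≤` identify the two labellings.
    component-injective : ∀ {S T} → S ≡ T → (S≤p : ∣ S ∣ ≤ p) (T≤p : ∣ T ∣ ≤ p) →
      ∀ {x y} (x∉ : x ∉ S) (y∉ : y ∉ T) →
      toℕ (proj₁ (sep S S≤p) x x∉) ≡ toℕ (proj₁ (sep T T≤p) y y∉) → ConnectedAvoiding G S x y
    component-injective {S} refl S≤p T≤p x∉ y∉ e with ℕ.≤-irrelevant S≤p T≤p
    ... | refl = proj₁ (proj₂ (sep S S≤p) _ _ x∉ y∉) (Fin.toℕ-injective e)

    -- Values below `d` label the component of `x` after deleting a small `U`; values from `d` on
    -- give the position of `x` in its twin class when `U` is large.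
    vertexColour : Vertex G → ℕ
    vertexColour x with ∣ Uset x ∣ ℕ.≤? p
    ... | yes U≤p = toℕ (proj₁ (sep (Uset x) U≤p) x (x∉Uset x))
    ... | no _ = d + toℕ (rank (x∈Twins x))

    vertexColour-< : ∀ x → vertexColour x < d + p
    vertexColour-< x with ∣ Uset x ∣ ℕ.≤? p
    ... | yes U≤p = ℕ.<-≤-trans (Fin.toℕ<n _) (ℕ.m≤m+n d p)
    ... | no U≰p = ℕ.+-monoʳ-< d (ℕ.<-trans (Fin.toℕ<n _) (few-twins x (ℕ.<⇒≤ (ℕ.≰⇒> U≰p))))

    -- Twins share `U` and so fall into the same case. Equal component labels put `y` into the
    -- subtree of `x`, where its only sibling is `x` itself; equal ranks refer to the same twin
    -- class.
    vertexColour-injective : ∀ {x y} → Twin x y → vertexColour x ≡ vertexColour y → x ≡ y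
    vertexColour-injective {x} {y} t e with ∣ Uset x ∣ ℕ.≤? p | ∣ Uset y ∣ ℕ.≤? p
    ... | yes Ux | no Uy = contradiction (subst (λ S → ∣ S ∣ ≤ p) (Uset-cong (proj₂ t)) Ux) Uy
    ... | no Ux | yes Uy = contradiction (subst (λ S → ∣ S ∣ ≤ p) (≡-sym (Uset-cong (proj₂ t))) Uy) Ux
    ... | no _ | no _ = rank-injective (Twins-cong t) (x∈Twins x) (x∈Twins y) (ℕ.+-cancelˡ-≡ d _ _ e)
    ... | yes Ux | yes Uy
            with Sib-≼⇒≡ (proj₁ t) (stays-below (∈⟪⟫⁺ (U-vertex? x))
                   (component-injective (Uset-cong (proj₂ t)) Ux Uy (x∉Uset x) (x∉Uset y) e) self)
    ...   | refl = refl

    -- The value 0 is reserved for edges, so an edge never shares a colour with a vertex.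
    colour : Elem G → ℕ
    colour (inj₁ x) = suc (vertexColour x)
    colour (inj₂ _) = 0

    colour-< : ∀ a → colour a < suc (d + p)
    colour-< (inj₁ x) = s≤s (vertexColour-< x)
    colour-< (inj₂ _) = s≤s z≤n

    -- For an edge, `U` is the set of its ends and already determines it.
    colour-injective : ∀ {a b} → Sib a b → SameU a b → colour a ≡ colour b → a ≡ b
    colour-injective {inj₁ x} {inj₁ y} s u e = cong inj₁ (vertexColour-injective (s , u) (ℕ.suc-injective e))
    colour-injective {inj₂ e} {inj₂ f} s u _ = cong inj₂ (Inc-⊆⇒≡ G sub)
      where
      sub : ∀ v → Inc G (inj₁ v) (inj₂ e) → Inc G (inj₁ v) (inj₂ f)
      sub v i with proj₁ (u (inj₁ v)) ((Inc⇒Anc-lower e i , λ ()) , inj₂ e , refl , i)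
      ... | _ , inj₂ _ , refl , j = j

-- Definability

impF iffF : ∀ {m k} → Formula m k → Formula m k → Formula m k
impF φ ψ = negF (andF φ (negF ψ))
iffF φ ψ = andF (impF φ ψ) (impF ψ φ)

module Definability {Model : Set} (graph : Model → Graph) {k : ℕ}
                    (params : (M : Model) → Fin k → ElemSet (graph M)) where

  Env : ℕ → Model → Set
  Env m M = Fin m → Elem (graph M)

  -- One formula for all models, with the relation it defines in each. Disjunction, implication and
  -- universal quantification are coded classically; `dec` reconciles them with their constructive
  -- reading.
  record Definable (m : ℕ) : Set₁ where
    field
      form    : Formula m k
      sem     : (M : Model) → Env m M → Set
      dec     : ∀ M ρ → Dec (sem M ρ)
      correct : ∀ M ρ → Sat (graph M) form ρ (params M) ⟺ sem M ρ
  open Definable public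

  private variable m : ℕ

  eqD incD : Fin m → Fin m → Definable m
  eqD x y = record
    { form = eqF x y ; sem = λ M ρ → ρ x ≡ ρ y
    ; dec = λ M ρ → _≟ₑ_ (graph M) (ρ x) (ρ y) ; correct = λ M ρ → id , id }
  incD x y = record
    { form = incF x y ; sem = λ M ρ → Inc (graph M) (ρ x) (ρ y)
    ; dec = λ M ρ → Inc? (graph M) (ρ x) (ρ y) ; correct = λ M ρ → id , id }

  negD : Definable m → Definable m
  negD A = record
    { form = negF (form A) ; sem = λ M ρ → ¬ sem A M ρ ; dec = λ M ρ → ¬? (dec A M ρ)
    ; correct = λ M ρ → (_∘ proj₂ (correct A M ρ)) , (_∘ proj₁ (correct A M ρ)) }

  andD orD impD iffD : Definable m → Definable m → Definable m
  andD A B = record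
    { form = andF (form A) (form B) ; sem = λ M ρ → sem A M ρ × sem B M ρ
    ; dec = λ M ρ → dec A M ρ ×-dec dec B M ρ
    ; correct = λ M ρ → (λ (a , b) → proj₁ (correct A M ρ) a , proj₁ (correct B M ρ) b) ,
                        (λ (a , b) → proj₂ (correct A M ρ) a , proj₂ (correct B M ρ) b) }
  orD A B = record
    { form = negF (andF (negF (form A)) (negF (form B))) ; sem = λ M ρ → sem A M ρ ⊎ sem B M ρ
    ; dec = λ M ρ → dec A M ρ ⊎-dec dec B M ρ
    ; correct = λ M ρ →
        (λ s → decidable-stable (dec A M ρ ⊎-dec dec B M ρ) λ ¬s →
           s (¬s ∘ inj₁ ∘ proj₁ (correct A M ρ) , ¬s ∘ inj₂ ∘ proj₁ (correct B M ρ))) ,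
        λ s (¬a , ¬b) → [ ¬a ∘ proj₂ (correct A M ρ) , ¬b ∘ proj₂ (correct B M ρ) ] s }
  impD A B = record
    { form = impF (form A) (form B) ; sem = λ M ρ → sem A M ρ → sem B M ρ
    ; dec = λ M ρ → dec A M ρ →-dec dec B M ρ
    ; correct = λ M ρ →
        (λ s a → decidable-stable (dec B M ρ) λ ¬b →
           s (proj₂ (correct A M ρ) a , ¬b ∘ proj₁ (correct B M ρ))) ,
        λ f (a , ¬b) → ¬b (proj₂ (correct B M ρ) (f (proj₁ (correct A M ρ) a))) }
  iffD A B = andD (impD A B) (impD B A)

  exD allD : Definable (suc m) → Definable m
  exD A = record
    { form = ex1F (form A) ; sem = λ M ρ → ∃ λ a → sem A M (a ◂ ρ)
    ; dec = λ M ρ → anyElem? (graph M) λ a → dec A M (a ◂ ρ)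
    ; correct = λ M ρ → (λ (a , s) → a , proj₁ (correct A M (a ◂ ρ)) s) ,
                        (λ (a , s) → a , proj₂ (correct A M (a ◂ ρ)) s) }
  allD A = record
    { form = negF (ex1F (negF (form A))) ; sem = λ M ρ → ∀ a → sem A M (a ◂ ρ)
    ; dec = λ M ρ → search-all (anyElem? (graph M)) λ a → dec A M (a ◂ ρ)
    ; correct = λ M ρ →
        (λ s a → decidable-stable (dec A M (a ◂ ρ)) λ ¬a → s (a , ¬a ∘ proj₁ (correct A M (a ◂ ρ)))) ,
        λ f (a , ¬s) → ¬s (proj₂ (correct A M (a ◂ ρ)) (f a)) }

  restate : (A : Definable m) (P : (M : Model) → Env m M → Set) →
            (∀ M ρ → sem A M ρ ⟺ P M ρ) → Definable m
  restate A P A⟺P = record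
    { form = form A ; sem = P ; dec = λ M ρ → map′ (proj₁ (A⟺P M ρ)) (proj₂ (A⟺P M ρ)) (dec A M ρ)
    ; correct = λ M ρ → proj₁ (A⟺P M ρ) ∘ proj₁ (correct A M ρ) , proj₂ (correct A M ρ) ∘ proj₂ (A⟺P M ρ) }

  someD : ∀ {q} → (Fin q → Definable m) → Definable m
  -- Falsity: some element differs from itself.
  someD {q = zero} A = exD (negD (eqD zero zero))
  someD {q = suc q} A = orD (A zero) (someD (A ∘ suc))

  someD-sem : ∀ {q} (A : Fin q → Definable m) M ρ → sem (someD A) M ρ ⟺ ∃ λ i → sem (A i) M ρ
  someD-sem {q = zero} A M ρ = (λ (_ , ne) → contradiction refl ne) , λ ()
  someD-sem {q = suc q} A M ρ = to , from
    where
    ih = someD-sem (A ∘ suc) M ρ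
    to : _ → _
    to (inj₁ s) = zero , s
    to (inj₂ s) = let i , r = proj₁ ih s in suc i , r
    from : (∃ λ i → sem (A i) M ρ) → _
    from (zero , s) = inj₁ s
    from (suc i , s) = inj₂ (proj₂ ih (i , s))

module _ {m k : ℕ} (b : Fin k) where

  -- x ≼ y iff x lies in every set Z ∋ y closed under the steps from an edge to its
  -- ends and from a vertex to its parent. Within the quantifier, set variable zero
  -- is Z and suc b is the marking.
  incClosedF : Formula m (suc k)
  incClosedF = negF (ex1F (ex1F (andF (incF zero (suc zero))
    (andF (memF (suc zero) zero) (negF (memF zero zero))))))

  -- From the outermost quantifier inwards: an edge, its end bearing the same mark, and the end
  -- reached.
  treeClosedF : Formula m (suc k)
  treeClosedF = negF (ex1F (ex1F (ex1F (andF
    (andF (andF (incF zero (suc (suc zero))) (incF (suc zero) (suc (suc zero))))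
          (iffF (memF (suc (suc zero)) (suc b)) (memF (suc zero) (suc b))))
    (andF (memF (suc zero) zero) (negF (memF zero zero)))))))

  leF : Fin m → Fin m → Formula m k
  leF x y = negF (ex2F (andF (andF (memF y zero) (negF (memF x zero))) (andF incClosedF treeClosedF)))

-- The hypothesis is what `Sat` of `iffF` between two `memF` unfolds to.
Sat-iff-mem⇒≡ : ∀ {s t : Bool} → ¬ (s ≡ true × ¬ t ≡ true) × ¬ (t ≡ true × ¬ s ≡ true) → s ≡ t
Sat-iff-mem⇒≡ {false} {false} _ = refl
Sat-iff-mem⇒≡ {true} {true} _ = refl
Sat-iff-mem⇒≡ {true} {false} (f , _) = contradiction (refl , λ ()) f
Sat-iff-mem⇒≡ {false} {true} (_ , f) = contradiction (refl , λ ()) f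

≡⇒Sat-iff-mem : ∀ {s t : Bool} → s ≡ t → ¬ (s ≡ true × ¬ t ≡ true) × ¬ (t ≡ true × ¬ s ≡ true)
≡⇒Sat-iff-mem refl = (λ (p , ¬p) → ¬p p) , (λ (p , ¬p) → ¬p p)

module _ {G : Graph} (F : Forest G) (normal : Normal F) where
  open Forest F
  open ElemOrder F normal

  module _ {m k : ℕ} (b : Fin k) (x y : Fin m) (ρ : Fin m → Elem G) (σ : Fin k → ElemSet G)
           (σ-mark : ∀ a → σ b a ≡ mark a) where

    -- The set of all elements `≼ ρ y` contains `ρ y` and is closed, so it can be taken for `Z`.
    leF⇒≼ : Sat G (leF b x y) ρ σ → ρ x ≼ ρ y
    leF⇒≼ s = decidable-stable (ρ x ≼? ρ y) λ x⋠y → s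
      ( (λ a → does (a ≼? ρ y))
      , (dec-true (ρ y ≼? ρ y) (≼-refl {ρ y}) , λ x∈ → x⋠y (does-true⇒ (ρ x ≼? ρ y) x∈))
      , (λ (e , u , i , e∈ , u∉) → u∉ (dec-true (u ≼? ρ y) (inc-up u e i (does-true⇒ (e ≼? ρ y) e∈))))
      , λ (e , v , u , ((i , j) , μ) , v∈ , u∉) → u∉ (dec-true (u ≼? ρ y)
          (tree-up u v e i j (≡-trans (≡-sym (σ-mark e)) (≡-trans (Sat-iff-mem⇒≡ μ) (σ-mark v)))
            (does-true⇒ (v ≼? ρ y) v∈))))
      where
      inc-up : ∀ u e → Inc G u e → e ≼ ρ y → u ≼ ρ y
      inc-up (inj₁ u) (inj₂ e) i = ≼-trans {inj₁ u} {inj₂ e} {ρ y} (Inc⇒Anc-lower e i)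
      -- Equal marks also occur on non-tree edges spanning an odd number of levels. Since `v` is
      -- then still the lower end, the step leads to an ancestor all the same.
      tree-up : ∀ u v e → Inc G u e → Inc G v e → mark e ≡ mark v → v ≼ ρ y → u ≼ ρ y
      tree-up (inj₁ u) (inj₁ v) (inj₂ e) i j μ = ≼-trans {inj₁ u} {inj₁ v} {ρ y}
        (subst (Anc F u) (≡-sym (mark-≡⇒lower e j μ)) (Inc⇒Anc-lower e i))

    -- Membership in a closed `Z` is passed from parent to parent; an edge first hands it to its
    -- lower end.
    ≼⇒leF : ρ x ≼ ρ y → Sat G (leF b x y) ρ σ
    ≼⇒leF x≼y (Z , (y∈ , x∉) , incClosed , treeClosed) = x∉ (reach (ρ x) (ρ y) x≼y y∈)
      where
      climb : ∀ {u v} → Anc F u v → Z (inj₁ v) ≡ true → Z (inj₁ u) ≡ true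
      climb self v∈ = v∈
      climb (above {u = w} {v = v} q a) v∈ with tree-edge q
      ... | e , i , j , μ = climb a (decidable-stable (Z (inj₁ w) Bool.≟ true) λ w∉ →
              treeClosed (inj₂ e , inj₁ v , inj₁ w ,
                ((i , j) , ≡⇒Sat-iff-mem (≡-trans (σ-mark _) (≡-trans μ (≡-sym (σ-mark _))))) , v∈ , w∉))
      reach : ∀ a c → a ≼ c → Z c ≡ true → Z a ≡ true
      reach (inj₁ u) (inj₁ v) p c∈ = climb p c∈
      reach (inj₁ u) (inj₂ e) p c∈ = climb p (decidable-stable (Z (inj₁ (lower e)) Bool.≟ true) λ l∉ →
        incClosed (inj₂ e , inj₁ (lower e) , lower-inc e , c∈ , l∉))
      reach (inj₂ e) (inj₂ e) refl c∈ = c∈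

-- The defining formula and its parameters

module _ (p d : ℕ) where

  Model : Set
  Model = Σ Graph (C p d)

  module _ (M : Model) where
    private G = proj₁ M

    forest : Forest G
    forest = proj₁ (normalForest G)

    forest-normal : Normal forest
    forest-normal = proj₂ (normalForest G)

    elemColour : Elem G → ℕ
    elemColour = colour forest forest-normal (proj₁ (proj₂ M)) (proj₂ (proj₂ M))

    elemColour-< : ∀ a → elemColour a < suc (d + p)
    elemColour-< = colour-< forest forest-normal (proj₁ (proj₂ M)) (proj₂ (proj₂ M))

    -- The marking, then the initial segments of the colouring. One colour is smaller than another
    -- exactly when some segment contains the first and misses the second.
    params : Fin (suc (suc (d + p))) → ElemSet G
    params zero = ElemOrder.mark forest forest-normal
    params (suc i) a = does (elemColour a ≤? toℕ i)

  open Definability proj₁ params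

  private variable m : ℕ

  memD : Fin m → Fin (suc (suc (d + p))) → Definable m
  memD x X = record
    { form = memF x X ; sem = λ M ρ → params M X (ρ x) ≡ true
    ; dec = λ M ρ → params M X (ρ x) Bool.≟ true ; correct = λ M ρ → id , id }

  -- Each clause mirrors a relation of `ForestOrder`, so that `sem` of `orderD` unfolds to `⊑` by
  -- definition.
  leD ltD sibD uD sameUD lexD colourD belowD branchD orderD : Fin m → Fin m → Definable m
  leD x y = record
    { form = leF zero x y
    ; sem = λ M ρ → ElemOrder._≼_ (forest M) (forest-normal M) (ρ x) (ρ y)
    ; dec = λ M ρ → ElemOrder._≼?_ (forest M) (forest-normal M) (ρ x) (ρ y)
    ; correct = λ M ρ →
        leF⇒≼ (forest M) (forest-normal M) zero x y ρ (params M) (λ _ → refl) ,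
        ≼⇒leF (forest M) (forest-normal M) zero x y ρ (params M) (λ _ → refl) }
  ltD x y = andD (leD x y) (negD (eqD x y))
  sibD x y = allD (iffD (ltD zero (suc x)) (ltD zero (suc y)))
  uD x a = andD (ltD a x) (exD (andD (leD (suc x) zero) (incD (suc a) zero)))
  sameUD x y = allD (iffD (uD (suc x) zero) (uD (suc y) zero))
  lexD x y = exD (andD (andD (uD (suc x) zero) (negD (uD (suc y) zero)))
    (allD (impD (ltD zero (suc zero)) (iffD (uD (suc (suc x)) zero) (uD (suc (suc y)) zero)))))
  colourD x y = restate (someD threshold)
    (λ M ρ → elemColour M (ρ x) < elemColour M (ρ y))
    λ M ρ → to M ρ ∘ proj₁ (someD-sem threshold M ρ) , proj₂ (someD-sem threshold M ρ) ∘ from M ρ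
    where
    threshold : Fin (suc (d + p)) → Definable _
    threshold i = andD (memD x (suc i)) (negD (memD y (suc i)))
    to : ∀ M ρ → (∃ λ i → sem (threshold i) M ρ) → elemColour M (ρ x) < elemColour M (ρ y)
    to M ρ (i , x∈ , y∉) = ℕ.≤-<-trans (does-true⇒ (elemColour M (ρ x) ≤? toℕ i) x∈)
      (ℕ.≰⇒> (y∉ ∘ dec-true (elemColour M (ρ y) ≤? toℕ i)))
    from : ∀ M ρ → elemColour M (ρ x) < elemColour M (ρ y) → (∃ λ i → sem (threshold i) M ρ)
    from M ρ l = i , dec-true (elemColour M (ρ x) ≤? toℕ i) (ℕ.≤-reflexive (≡-sym i≡)) ,
      λ y∈ → ℕ.<⇒≱ l (subst (elemColour M (ρ y) ≤_) i≡ (does-true⇒ (elemColour M (ρ y) ≤? toℕ i) y∈))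
      where
      -- The segment ending at the colour of `ρ x` contains `ρ x` but not `ρ y`.
      i = fromℕ< (elemColour-< M (ρ x))
      i≡ = Fin.toℕ-fromℕ< (elemColour-< M (ρ x))
  belowD x y = andD (sibD x y) (orD (lexD x y) (andD (sameUD x y) (colourD x y)))
  branchD x y = exD (exD (andD (andD (leD (suc zero) (suc (suc x))) (leD zero (suc (suc y))))
    (belowD (suc zero) zero)))
  orderD x y = orD (leD x y) (branchD x y)

  linearOrder : (M : Model) → IsLinearOrder λ a b → sem (orderD {2} zero (suc zero)) M (a ◂ (b ◂ λ ()))
  linearOrder M = ElemOrder.Coloured.⊑-isLinearOrder (forest M) (forest-normal M) (elemColour M)
    (λ {a} {b} → colour-injective (forest M) (forest-normal M) (proj₁ (proj₂ M)) (proj₂ (proj₂ M)) {a} {b})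

IsLinearOrder-resp : {A : Set} {R S : A → A → Set} → (∀ a b → R a b ⟺ S a b) → IsLinearOrder S → IsLinearOrder R
IsLinearOrder-resp R⟺S L = record
  { refl = λ a → proj₂ (R⟺S a a) (L.refl a)
  ; antisym = λ a b r s → L.antisym a b (proj₁ (R⟺S a b) r) (proj₁ (R⟺S b a) s)
  ; trans = λ a b c r s → proj₂ (R⟺S a c) (L.trans a b c (proj₁ (R⟺S a b) r) (proj₁ (R⟺S b c) s))
  ; total = λ a b → Sum.map (proj₂ (R⟺S a b)) (proj₂ (R⟺S b a)) (L.total a b) }
  where module L = IsLinearOrder L

theorem4p12 : (p d : ℕ) → MSO2-orderable (C p d)
theorem4p12 p d = suc (suc (d + p)) , form , λ G c _ → params p d (G , c) ,
  IsLinearOrder-resp (λ a b → correct (G , c) (a ◂ (b ◂ λ ()))) (linearOrder p d (G , c))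
  where
  open Definability.Definable (orderD p d {2} zero (suc zero))
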